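{- Let $\kappa$ be a regular cardinal and let $A,B$ be meet-semilattices with $A\subseteq B\subseteq \mathcal{BL} A$, where $A$ is identified with $\{{\downarrow}a:a\in A\}$, $A$ is a sub-meet-semilattice of $B$ and $B$ is a sub-meet-semilattice of $\mathcal{BL} A$. The following are equivalent: (1) $B$ is a $\kappa$-frame; (2) $B$ is a sub-$\kappa$-frame of $\mathcal{BL} A$ (i.e., closed under finite meets and under joins of fewer than $\kappa$ elements computed in $\mathcal{BL} A$); (3) the sub-$\kappa$-frame of $\mathcal{BL} A$ generated by $B$ equals $B$.
   Context: A meet-semilattice is a poset with all finite meets. For $S\subseteq A$ with $\bigvee S$ existing in $A$, the join is distributive if $a\wedge\bigvee S=\bigvee\{a\wedge s:s\in S\}$ for all $a\in A$. A D-ideal is a downset $E$ with $\bigvee S\in E$ whenever $S\subseteq E$ has a distributive join; $\mathcal{BL} A$ is the frame of D-ideals of $A$ ordered by inclusion, into which $A$ embeds via $a\mapsto{\downarrow}a$. For a regular cardinal $\kappa$, a $\kappa$-set is a set of cardinality $<\kappa$ and a $\kappa$-join is a join of a $\kappa$-set. A meet-semilattice is $\kappa$-complete if all $\kappa$-joins exist, $\kappa$JD if every existing $\kappa$-join is distributive, and a $\kappa$-frame if it is both $\kappa$-complete and $\kappa$JD. -}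

module Defs where

open import Level using (Level; suc; _⊔_)
open import Data.Nat.Base using (ℕ)
open import Data.Product.Base using (Σ; ∃; _×_; _,_; proj₁; proj₂)
open import Function.Base using (_on_; id; _∘_)
open import Function.Bundles using (_↣_; _↠_; Bijection)
open import Relation.Binary.Bundles using (Poset; Setoid)
open import Relation.Binary.Lattice.Bundles using (BoundedMeetSemilattice)
import Relation.Binary.Construct.On as On
import Relation.Binary.PropositionalEquality.Properties as ≡
open import Relation.Nullary.Negation.Core using (¬_)
open import Relation.Unary using (Pred; _⊆_; _∩_)

private
  variable
    a b c p q ℓ ℓ₁ ℓ₂ : Level

-- Cardinals are represented by types, compared through injections.

infix 4 _≺_

_≺_ : Set a → Set b → Set (a ⊔ b)
I ≺ K = (I ↣ K) × ¬ (K ↣ I)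

-- An infinite cardinal is regular when it is not the union of fewer than κ
-- sets of cardinality less than κ; such a union is a surjective image of the
-- disjoint union Σ I J.
record RegularCardinal (ℓ : Level) : Set (suc ℓ) where
  field
    Carrier  : Set ℓ
    infinite : ℕ ↣ Carrier
    regular  : (I : Set ℓ) (J : I → Set ℓ) → I ≺ Carrier →
               (∀ i → J i ≺ Carrier) → ¬ (Σ I J ↠ Carrier)

subsetoid : (X : Setoid a b) → Pred (Setoid.Carrier X) p → Setoid (a ⊔ p) b
subsetoid X S = On.setoid X (proj₁ {B = S})

-- "S has cardinality less than κ", elements being counted up to the equality
-- of the ambient setoid.
IsκSet : RegularCardinal ℓ → (X : Setoid a b) → Pred (Setoid.Carrier X) p →
         Set (suc ℓ ⊔ a ⊔ b ⊔ p)
IsκSet {ℓ = ℓ} κ X S =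
  Σ (Set ℓ) λ I → (I ≺ RegularCardinal.Carrier κ) × Bijection (≡.setoid I) (subsetoid X S)

-- A meet-semilattice has all finite meets, hence a top element.
module _ (L : BoundedMeetSemilattice c ℓ₁ ℓ₂) where
  open BoundedMeetSemilattice L

  record IsJoin (S : Pred Carrier p) (x : Carrier) : Set (c ⊔ ℓ₂ ⊔ p) where
    field
      upper : ∀ {s} → S s → s ≤ x
      least : ∀ {u} → (∀ {s} → S s → s ≤ u) → x ≤ u

  meetWith : Carrier → Pred Carrier p → Pred Carrier (c ⊔ ℓ₁ ⊔ p)
  meetWith y S z = ∃ λ s → S s × z ≈ y ∧ s

  record IsDistributiveJoin (S : Pred Carrier p) (x : Carrier) : Set (c ⊔ ℓ₁ ⊔ ℓ₂ ⊔ p) where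
    field
      isJoin       : IsJoin S x
      distributive : ∀ y → IsJoin (meetWith y S) (y ∧ x)

  record IsSubMeetSemilattice (B : Pred Carrier p) : Set (c ⊔ ℓ₁ ⊔ p) where
    field
      resp     : ∀ {x y} → x ≈ y → B x → B y
      ⊤-closed : B ⊤
      ∧-closed : ∀ {x y} → B x → B y → B (x ∧ y)

  sub : (B : Pred Carrier p) → IsSubMeetSemilattice B →
        BoundedMeetSemilattice (c ⊔ p) ℓ₁ ℓ₂
  sub B isSub = record
    { Carrier = ∃ B
    ; _≈_     = _≈_ on proj₁
    ; _≤_     = _≤_ on proj₁
    ; _∧_     = λ (x , x∈B) (y , y∈B) → x ∧ y , ∧-closed x∈B y∈B
    ; ⊤       = ⊤ , ⊤-closed
    ; isBoundedMeetSemilattice = record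
      { isMeetSemilattice = record
        { isPartialOrder = On.isPartialOrder proj₁ isPartialOrder
        ; infimum        = λ (x , _) (y , _) →
            let l , r , g = infimum x y in l , r , λ (z , _) → g z
        }
      ; maximum = λ (x , _) → maximum x
      }
    }
    where open IsSubMeetSemilattice isSub

-- Subsets are taken at the level ℓ of the equality.  For κ-sets this is no
-- restriction even if the elements live in a larger universe: a κ-set is,
-- up to equality of its elements, the image of a family indexed by a type in
-- Set ℓ.
module _ (κ : RegularCardinal ℓ) (L : BoundedMeetSemilattice c ℓ ℓ) where
  open BoundedMeetSemilattice L
  open Poset.Eq poset using (setoid)

  IsκComplete : Set (c ⊔ suc ℓ)
  IsκComplete = (S : Pred Carrier ℓ) → IsκSet κ setoid S → ∃ λ x → IsJoin L S x

  IsκJD : Set (c ⊔ suc ℓ)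
  IsκJD = (S : Pred Carrier ℓ) (x : Carrier) → IsκSet κ setoid S →
          IsJoin L S x → IsDistributiveJoin L S x

  record IsκFrame : Set (c ⊔ suc ℓ) where
    field
      κ-complete : IsκComplete
      κ-JD       : IsκJD

  record IsSubκFrame (B : Pred Carrier p) : Set (c ⊔ suc ℓ ⊔ p) where
    field
      isSubMeetSemilattice : IsSubMeetSemilattice L B
      κ-join-closed : (S : Pred Carrier ℓ) → IsκSet κ setoid S → S ⊆ B →
                      ∃ λ x → IsJoin L S x × B x

  data Generated (B : Pred Carrier p) : Pred Carrier (c ⊔ suc ℓ ⊔ p) where
    incl   : B ⊆ Generated B
    resp   : ∀ {x y} → x ≈ y → Generated B x → Generated B y
    top    : Generated B ⊤
    meet   : ∀ {x y} → Generated B x → Generated B y → Generated B (x ∧ y)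
    κ-join : (S : Pred Carrier ℓ) → IsκSet κ setoid S → S ⊆ Generated B →
             ∀ {x} → IsJoin L S x → Generated B x

module _ (A : BoundedMeetSemilattice ℓ ℓ ℓ) where
  open BoundedMeetSemilattice A

  record DIdeal : Set (suc ℓ) where
    field
      mem         : Pred Carrier ℓ
      downset     : ∀ {x y} → x ≤ y → mem y → mem x
      join-closed : (S : Pred Carrier ℓ) → S ⊆ mem →
                    ∀ {x} → IsDistributiveJoin A S x → mem x

  open DIdeal

  -- Inclusion-ordered; finite meets are intersections.
  𝓑𝓛 : BoundedMeetSemilattice (suc ℓ) ℓ ℓ
  𝓑𝓛 = record
    { Carrier = DIdeal
    ; _≈_     = λ E F → (mem E ⊆ mem F) × (mem F ⊆ mem E)
    ; _≤_     = λ E F → mem E ⊆ mem F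
    ; _∧_     = λ E F → record
      { mem         = mem E ∩ mem F
      ; downset     = λ x≤y (y∈E , y∈F) → downset E x≤y y∈E , downset F x≤y y∈F
      ; join-closed = λ S S⊆ j →
          join-closed E S (proj₁ ∘ S⊆) j , join-closed F S (proj₂ ∘ S⊆) j
      }
    ; ⊤       = record
      { mem         = λ x → x ≤ ⊤
      ; downset     = trans
      ; join-closed = λ _ _ {x} _ → maximum x
      }
    ; isBoundedMeetSemilattice = record
      { isMeetSemilattice = record
        { isPartialOrder = record
          { isPreorder = record
            { isEquivalence = record
              { refl  = id , id
              ; sym   = λ (f , g) → g , f
              ; trans = λ (f , g) (h , k) → h ∘ f , g ∘ k
              }
            ; reflexive = proj₁
            ; trans     = λ f g → g ∘ f
            }
          ; antisym = _,_
          }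
        ; infimum = λ _ _ → proj₁ , proj₂ , λ _ f g x → f x , g x
        }
      ; maximum = λ _ {x} _ → maximum x
      }
    }

  ↓_ : Carrier → DIdeal
  ↓ a = record
    { mem         = _≤ a
    ; downset     = trans
    ; join-closed = λ S S⊆ j → IsJoin.least (IsDistributiveJoin.isJoin j) S⊆
    }

  IsPrincipal : Pred DIdeal ℓ
  IsPrincipal E = ∃ λ a → BoundedMeetSemilattice._≈_ 𝓑𝓛 E (↓ a)

{-# OPTIONS --safe #-}

-- The join of D-ideals Eᵢ consists of the x such that every y ≤ x is the join
-- of the elements of ⋃ Eᵢ below it.  This makes 𝓑𝓛 A a frame, so sub-κ-frames
-- of it are κ-frames.  Conversely, if B ⊇ A is a κ-frame and x ∈ B is the join
-- in B of a κ-set of D-ideals, then for y ∈ x distributivity of ↓ y over that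
-- join, tested against the upper bounds ↓ v, exhibits y as a join in A of
-- members of those D-ideals, so x is their join in 𝓑𝓛 A as well.

module Submission where

open import Defs
open import Data.Product.Base using (∃; _×_; _,_; proj₁; proj₂)
open import Function.Base using (_∘_)
open import Function.Bundles using (_⇔_; mk⇔; Bijection)
open import Level using (Level)
open import Relation.Binary.Bundles using (Poset; Setoid)
open import Relation.Binary.Lattice.Bundles using (BoundedMeetSemilattice)
open import Relation.Binary.PropositionalEquality.Core using (refl)
open import Relation.Unary using (Pred; _⊆_; _≐_)

private
  variable
    a b c p ℓ : Level

-- Enumerations of κ-sets.

module _ (κ : RegularCardinal ℓ) (X : Setoid a b) {S : Pred (Setoid.Carrier X) p}
         (S-κ : IsκSet κ X S) where
  open Setoid X using (Carrier; _≈_)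
  private module E = Bijection (proj₂ (proj₂ S-κ))

  Index : Set ℓ
  Index = proj₁ S-κ

  enum : Index → Carrier
  enum i = proj₁ (E.to i)

  enum∈ : ∀ i → S (enum i)
  enum∈ i = proj₂ (E.to i)

  enum-surjective : ∀ {s} → S s → ∃ λ i → enum i ≈ s
  enum-surjective {s} s∈S = let i , eq = E.surjective (s , s∈S) in i , eq refl

-- Generated sub-κ-frames, and κ-sets and joins in a sub-semilattice.

module _ (L : BoundedMeetSemilattice c ℓ ℓ) where
  open BoundedMeetSemilattice L hiding (refl)
  open Poset.Eq poset using (setoid)

  IsJoin-unique : ∀ {S : Pred Carrier p} {x y} → IsJoin L S x → IsJoin L S y → x ≈ y
  IsJoin-unique j k = antisym (J.least K.upper) (K.least J.upper)
    where module J = IsJoin j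
          module K = IsJoin k

  IsSubκFrame⇒Generated≐ : ∀ {κ : RegularCardinal ℓ} {B : Pred Carrier p} →
                           IsSubκFrame κ L B → Generated κ L B ≐ B
  IsSubκFrame⇒Generated≐ {B = B} B-frame = go , incl
    where
    open IsSubκFrame B-frame
    module M = IsSubMeetSemilattice isSubMeetSemilattice

    go : Generated _ L B ⊆ B
    go (incl x∈B)                = x∈B
    go (resp x≈y x∈G)            = M.resp x≈y (go x∈G)
    go top                       = M.⊤-closed
    go (meet x∈G y∈G)            = M.∧-closed (go x∈G) (go y∈G)
    go (κ-join S S-κ S⊆G x-join) =
      -- Closure only provides some join `y` in `B`; uniqueness of joins carries membership over to
      -- the given one.
      let y , y-join , y∈B = κ-join-closed S S-κ (λ s∈S → go (S⊆G s∈S))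
      in M.resp (IsJoin-unique y-join x-join) y∈B

  module _ (κ : RegularCardinal ℓ) {B : Pred Carrier p} (B≤L : IsSubMeetSemilattice L B) where
    private
      subL = sub L B B≤L
      subX = Poset.Eq.setoid (BoundedMeetSemilattice.poset subL)

    -- Equality in `subL` compares first components only, so the same enumeration serves.
    IsκSet-restrict : ∀ {S : Pred Carrier ℓ} → S ⊆ B → IsκSet κ setoid S →
                      IsκSet κ subX (S ∘ proj₁)
    IsκSet-restrict S⊆B (I , I≺κ , f) = I , I≺κ , record
      { to        = λ i → let s , s∈S = F.to i in (s , S⊆B s∈S) , s∈S
      ; cong      = F.cong
      ; bijective = F.injective , λ ((s , _) , s∈S) → F.surjective (s , s∈S)
      }
      where module F = Bijection f

    -- The image of S under the inclusion of B; indexing by I rather than by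
    -- elements of B keeps it at level ℓ.
    image : {S : Pred (∃ B) ℓ} → IsκSet κ subX S → Pred Carrier ℓ
    image S-κ x = ∃ λ i → proj₁ (enum κ subX S-κ i) ≈ x

    image⊆ : ∀ {S : Pred (∃ B) ℓ} (S-κ : IsκSet κ subX S) → image S-κ ⊆ B
    image⊆ S-κ (i , eq) = IsSubMeetSemilattice.resp B≤L eq (proj₂ (enum κ subX S-κ i))

    IsκSet-image : ∀ {S : Pred (∃ B) ℓ} (S-κ : IsκSet κ subX S) →
                   IsκSet κ setoid (image S-κ)
    IsκSet-image (I , I≺κ , f) = I , I≺κ , record
      { to        = λ i → proj₁ (proj₁ (F.to i)) , i , Eq.refl
      ; cong      = F.cong
      ; bijective = F.injective , λ (_ , i , eq) → i , λ { refl → eq }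
      }
      where module F = Bijection f

    -- The upper bounds in `B` are among those in `L`, so leastness is inherited.
    IsJoin-image : ∀ {S : Pred (∃ B) ℓ} (S-κ : IsκSet κ subX S) {x} (x∈B : B x) →
                   IsJoin L (image S-κ) x → IsJoin subL S (x , x∈B)
    IsJoin-image S-κ x∈B j = record
      { upper = λ s∈S → J.upper (enum-surjective κ subX S-κ s∈S)
      ; least = λ S≤u → J.least λ (i , eq) →
          trans (reflexive (Eq.sym eq)) (S≤u (enum∈ κ subX S-κ i))
      }
      where module J = IsJoin j

-- Joins and distributivity in `𝓑𝓛 A`.

module _ (A : BoundedMeetSemilattice ℓ ℓ ℓ) where
  open BoundedMeetSemilattice A renaming (refl to ≤-refl)
  open DIdeal
  private
    module 𝓛 = BoundedMeetSemilattice (𝓑𝓛 A)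
    X = Poset.Eq.setoid 𝓛.poset

  -- Testing every `y ≤ x`, and not `x` alone, builds in distributivity.
  Covers : Pred Carrier ℓ → Pred Carrier ℓ
  Covers U x = ∀ {y v} → y ≤ x → (∀ {u} → u ≤ y → U u → u ≤ v) → y ≤ v

  Covers⇒IsDistributiveJoin : ∀ {U x} → Covers U x →
                              IsDistributiveJoin A (λ u → u ≤ x × U u) x
  Covers⇒IsDistributiveJoin cov = record
    { isJoin = record
      { upper = proj₁
      ; least = λ U≤v → cov ≤-refl λ u≤x u∈U → U≤v (u≤x , u∈U)
      }
    ; distributive = λ y → record
      { upper = λ (s , (s≤x , _) , z≈) → trans (reflexive z≈)
          (∧-greatest (x∧y≤x y s) (trans (x∧y≤y y s) s≤x))
      -- An element `u ≤ y ∧ x` of `U` equals `y ∧ u`, so it is one of the meets bounded by `v`.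
      ; least = λ yU≤v → cov (x∧y≤y y _) λ {u} u≤y∧x u∈U → yU≤v
          ( u
          , (trans u≤y∧x (x∧y≤y y _) , u∈U)
          , antisym (∧-greatest (trans u≤y∧x (x∧y≤x y _)) ≤-refl) (x∧y≤y y u)
          )
      }
    }

  -- Intersecting all D-ideals above the family would quantify over `Set (suc ℓ)`; `Covers`
  -- quantifies over elements of `A` and stays at level `ℓ`.
  ⋁ : {I : Set ℓ} → (I → DIdeal A) → DIdeal A
  ⋁ f = record
    { mem         = Covers (λ a → ∃ λ i → mem (f i) a)
    ; downset     = λ x≤y cov z≤x → cov (trans z≤x x≤y)
    -- By distributivity `y ∧ x` is the join of the `y ∧ s`, and each of these is below `v` because
    -- `s` is covered.
    ; join-closed = λ S S⊆ {x} j {y} y≤x below →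
        trans (∧-greatest ≤-refl y≤x)
          (IsJoin.least (IsDistributiveJoin.distributive j y)
            λ (s , s∈S , z≈) → trans (reflexive z≈)
              (S⊆ s∈S (x∧y≤y y s) λ u≤y∧s → below (trans u≤y∧s (x∧y≤x y s))))
    }

  ⋁-upper : {I : Set ℓ} (f : I → DIdeal A) → ∀ i → f i 𝓛.≤ ⋁ f
  ⋁-upper f i x∈fi y≤x below = below ≤-refl (i , downset (f i) y≤x x∈fi)

  -- A covered element is a distributive join of members of the `f i`, all of which lie in `E`.
  ⋁-least : {I : Set ℓ} (f : I → DIdeal A) → ∀ {E} → (∀ i → f i 𝓛.≤ E) → ⋁ f 𝓛.≤ E
  ⋁-least f {E} f≤E cov =
    join-closed E _ (λ (_ , i , u∈fi) → f≤E i u∈fi) (Covers⇒IsDistributiveJoin cov)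

  -- Everything below `x ∈ E` is in `E`, so intersecting with `E` loses no covering element.
  ∧-distribˡ-⋁ : {I : Set ℓ} (f : I → DIdeal A) → ∀ E → (E 𝓛.∧ ⋁ f) 𝓛.≤ ⋁ (λ i → E 𝓛.∧ f i)
  ∧-distribˡ-⋁ f E (x∈E , cov) y≤x below = cov y≤x λ u≤y (i , u∈fi) →
    below u≤y (i , downset E (trans u≤y y≤x) x∈E , u∈fi)

  module _ (κ : RegularCardinal ℓ) where

    ⋁-IsJoin : ∀ {S : Pred (DIdeal A) ℓ} (S-κ : IsκSet κ X S) → IsJoin (𝓑𝓛 A) S (⋁ (enum κ X S-κ))
    ⋁-IsJoin S-κ = record
      { upper = λ s∈S → let i , eq = enum-surjective κ X S-κ s∈S in
          λ x∈s → ⋁-upper (enum κ X S-κ) i (proj₂ eq x∈s)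
      ; least = λ {E} S≤E → ⋁-least (enum κ X S-κ) {E} λ i → S≤E (enum∈ κ X S-κ i)
      }

    -- The implications between the three conditions.

    module _ {B : Pred (DIdeal A) b} (B≤𝓑𝓛 : IsSubMeetSemilattice (𝓑𝓛 A) B) where
      private
        subB = sub (𝓑𝓛 A) B B≤𝓑𝓛
        module 𝓑 = BoundedMeetSemilattice subB
        subX = Poset.Eq.setoid 𝓑.poset

      Generated≐⇒IsSubκFrame : Generated κ (𝓑𝓛 A) B ≐ B → IsSubκFrame κ (𝓑𝓛 A) B
      Generated≐⇒IsSubκFrame (G⊆B , _) = record
        { isSubMeetSemilattice = B≤𝓑𝓛
        ; κ-join-closed = λ S S-κ S⊆B →
            ⋁ (enum κ X S-κ) , ⋁-IsJoin S-κ , G⊆B (κ-join S S-κ (incl ∘ S⊆B) (⋁-IsJoin S-κ))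
        }

      IsSubκFrame⇒IsκFrame : IsSubκFrame κ (𝓑𝓛 A) B → IsκFrame κ subB
      IsSubκFrame⇒IsκFrame B-sub = record
        { κ-complete = λ S S-κ → let x , j , x∈B = joinOf S-κ in
            (x , x∈B) , IsJoin-image (𝓑𝓛 A) κ B≤𝓑𝓛 S-κ x∈B j
        ; κ-JD       = λ S x S-κ j → record
          { isJoin       = j
          ; distributive = distributive S-κ j
          }
        }
        where
        open IsSubκFrame B-sub

        joinOf : {S : Pred (∃ B) ℓ} (S-κ : IsκSet κ subX S) →
                 ∃ λ x → IsJoin (𝓑𝓛 A) (image (𝓑𝓛 A) κ B≤𝓑𝓛 S-κ) x × B x
        joinOf S-κ = κ-join-closed _ (IsκSet-image (𝓑𝓛 A) κ B≤𝓑𝓛 S-κ) (image⊆ (𝓑𝓛 A) κ B≤𝓑𝓛 S-κ)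

        distributive : ∀ {S : Pred (∃ B) ℓ} (S-κ : IsκSet κ subX S) {x} → IsJoin subB S x →
                       ∀ y → IsJoin subB (meetWith subB y S) (y 𝓑.∧ x)
        distributive S-κ {x , _} j y@(E , _) = record
          { upper = λ (_ , s∈S , z≈) z∈ → let w∈E , w∈s = proj₁ z≈ z∈ in
              w∈E , IsJoin.upper j s∈S w∈s
          ; least = λ {(F , _)} ES≤F (w∈E , w∈x) →
              ⋁-least (λ i → E 𝓛.∧ f i) {F}
                (λ i → ES≤F {y 𝓑.∧ enum κ subX S-κ i}
                  (enum κ subX S-κ i , enum∈ κ subX S-κ i , 𝓛.Eq.refl {E 𝓛.∧ f i}))
                (∧-distribˡ-⋁ f E (w∈E , x≤⋁f w∈x))
          }
          where
          f : Index κ subX S-κ → DIdeal A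
          f = proj₁ ∘ enum κ subX S-κ

          -- `x` is least only among bounds in `B`, so it is first compared with `x′`, a join in
          -- `𝓑𝓛 A` that lies in `B`, and `x′` then with `⋁ f`.
          x≤⋁f : x 𝓛.≤ ⋁ f
          x≤⋁f w∈x =
            let x′ , j′ , x′∈B = joinOf S-κ
            in IsJoin.least j′ {⋁ f} (λ (i , eq) w∈s → ⋁-upper f i (proj₂ eq w∈s))
                 (IsJoin.least j {x′ , x′∈B}
                   (IsJoin.upper (IsJoin-image (𝓑𝓛 A) κ B≤𝓑𝓛 S-κ x′∈B j′)) w∈x)

      IsκFrame⇒IsSubκFrame : IsPrincipal A ⊆ B → IsκFrame κ subB → IsSubκFrame κ (𝓑𝓛 A) B
      IsκFrame⇒IsSubκFrame A⊆B B-frame = record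
        { isSubMeetSemilattice = B≤𝓑𝓛
        ; κ-join-closed        = closed
        }
        where
        open IsκFrame B-frame

        ↓ᴮ_ : Carrier → ∃ B
        ↓ᴮ y = ↓_ A y , A⊆B (y , 𝓛.Eq.refl {↓_ A y})

        closed : (S : Pred (DIdeal A) ℓ) → IsκSet κ X S → S ⊆ B →
                 ∃ λ x → IsJoin (𝓑𝓛 A) S x × B x
        closed S S-κ S⊆B = x , record
          { upper = λ s∈S → J.upper {_ , S⊆B s∈S} s∈S
          ; least = λ {E} S≤E w∈x → IsJoin.least (⋁-IsJoin S-κ) {E} S≤E (x≤⋁S w∈x)
          } , x∈B
          where
          S′-κ : IsκSet κ subX (S ∘ proj₁)
          S′-κ = IsκSet-restrict (𝓑𝓛 A) κ B≤𝓑𝓛 S⊆B S-κ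

          completion = κ-complete _ S′-κ
          x   = proj₁ (proj₁ completion)
          x∈B = proj₂ (proj₁ completion)
          module J = IsJoin (proj₂ completion)
          module D = IsDistributiveJoin (κ-JD _ _ S′-κ (proj₂ completion))

          x≤⋁S : x 𝓛.≤ ⋁ (enum κ X S-κ)
          x≤⋁S w∈x {y} {v} y≤w below =
            -- Both `↓ y` and `↓ v` are in `B`; since `y` lies in `↓ y ∧ x`, the resulting inclusion
            -- in `↓ v` says `y ≤ v`.
            IsJoin.least (D.distributive (↓ᴮ y)) {↓ᴮ v}
              (λ (_ , s∈S , z≈) u∈z →
                let u≤y , u∈s = proj₁ z≈ u∈z
                    i , eq    = enum-surjective κ X S-κ s∈S
                in below u≤y (i , proj₂ eq u∈s))
              (≤-refl , downset x y≤w w∈x)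

theorem3p7 : ∀ {ℓ b : Level} (κ : RegularCardinal ℓ) (A : BoundedMeetSemilattice ℓ ℓ ℓ)
    (B : Pred (DIdeal A) b) (B≤𝓑𝓛 : IsSubMeetSemilattice (𝓑𝓛 A) B) →
    IsPrincipal A ⊆ B →
    IsSubMeetSemilattice (sub (𝓑𝓛 A) B B≤𝓑𝓛) (IsPrincipal A ∘ proj₁) →
    (IsκFrame κ (sub (𝓑𝓛 A) B B≤𝓑𝓛) ⇔ IsSubκFrame κ (𝓑𝓛 A) B) ×
    (IsSubκFrame κ (𝓑𝓛 A) B ⇔ (Generated κ (𝓑𝓛 A) B ≐ B))
theorem3p7 κ A B B≤𝓑𝓛 A⊆B _ =
  mk⇔ (IsκFrame⇒IsSubκFrame A κ B≤𝓑𝓛 A⊆B) (IsSubκFrame⇒IsκFrame A κ B≤𝓑𝓛) ,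
  mk⇔ (IsSubκFrame⇒Generated≐ (𝓑𝓛 A)) (Generated≐⇒IsSubκFrame A κ B≤𝓑𝓛)
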